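{- Let $G$ be a graph without isolated vertices. The following statements hold. (i) If $G$ is an efficient closed domination graph, then for any graph $H$ with $2\le |V(H)|\le \Delta(H)+\delta(H)+1$, $$\gamma_R^p(G\circ H)=\gamma(G)(|V(H)|-\Delta(H)+1).$$ (ii) If $\gamma^p(G)=\gamma_t(G)=\gamma(G)$ and $G$ is an efficient open domination graph, then for any nontrivial graph $H$ with $|V(H)|\ge \Delta(H)+\delta(H)+1$, $$\gamma_R^p(G\circ H)=\gamma(G)(2+\delta(H)).$$
   Context: All graphs are finite, simple and undirected; a graph is nontrivial if it has at least two vertices. $\delta(H)$ and $\Delta(H)$ are the minimum and maximum degrees of $H$. $N(v)$ is the open neighbourhood and $N[v]=N(v)\cup\{v\}$. $\gamma(G)$, $\gamma^p(G)$, $\gamma_t(G)$ are, respectively, the minimum sizes of a dominating set (every vertex outside $S$ has at least one neighbour in $S$), a perfect dominating set (every vertex outside $S$ has exactly one neighbour in $S$), and a total dominating set (every vertex of $G$ has at least one neighbour in $S$; $G$ without isolated vertices). $G$ is an efficient open domination graph if there is a set $D\subseteq V(G)$ with $V(G)=\bigcup_{u\in D}N(u)$ and $N(u)\cap N(v)=\varnothing$ for all distinct $u,v\in D$. $G$ is an efficient closed domination graph if there is a dominating set $S$ of $G$ with $N[u]\cap N[v]=\varnothing$ for all distinct $u,v\in S$. A perfect Roman dominating function (PRDF) on a graph $\Gamma$ is a function $f:V(\Gamma)\to\{0,1,2\}$ such that every vertex $u$ with $f(u)=0$ is adjacent to exactly one vertex $v$ with $f(v)=2$. Its weight is $\sum_v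 f(v)$, and $\gamma_R^p(\Gamma)$ is the minimum weight of a PRDF on $\Gamma$. The lexicographic product $G\circ H$ has vertex set $V(G)\times V(H)$, with $(u,v)$ adjacent to $(x,y)$ iff $ux\in E(G)$, or $u=x$ and $vy\in E(H)$. -}

module Defs where

open import Data.Empty using (⊥-elim)
open import Data.Fin using (Fin; toℕ; remQuot; _≟_)
open import Data.Fin.Patterns using (0F; 1F; 2F)
open import Data.Fin.Properties using (any?; all?)
open import Data.Fin.Subset using (Subset; _∈_; _∉_; _∩_; _∪_; ⁅_⁆; ⊤; ∣_∣; Empty)
open import Data.Fin.Subset.Properties using (_∈?_; ∈⊤; anySubset?)
open import Data.List using (List; allFin) renaming (map to mapᴸ)
open import Data.List.Extrema.Nat using (min; max)
open import Data.Nat using (ℕ; zero; suc; _+_; _*_; _≤_; z≤n) renaming (_≟_ to _≟ᴺ_)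
open import Data.Nat.Properties using (+-identityʳ; +-suc; ≤∧≢⇒<)
open import Data.Product using (∃; ∃!; _×_; _,_; proj₁; proj₂)
open import Data.Sum using (_⊎_; inj₁; inj₂)
open import Data.Vec using (Vec; []; _∷_; lookup; tabulate; replicate; sum; map)
open import Data.Vec.Properties using (lookup-replicate)
open import Level using (0ℓ)
open import Relation.Binary using (Rel; Symmetric; Irreflexive)
  renaming (Decidable to Decidable₂)
open import Relation.Binary.PropositionalEquality using (_≡_; _≢_; refl; sym; trans)
open import Relation.Nullary using (Dec; yes; no; does; ¬_)
open import Relation.Nullary.Decidable using (map′; ¬?; _×-dec_; _⊎-dec_; _→-dec_)
open import Relation.Unary using (Pred; Decidable)

record Graph (n : ℕ) : Set₁ where
  field
    Adj        : Rel (Fin n) 0ℓ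
    adj?       : Decidable₂ Adj
    adj-sym    : Symmetric Adj
    adj-irrefl : Irreflexive _≡_ Adj

open Graph public

private variable
  m n : ℕ

N : Graph n → Fin n → Subset n
N G v = tabulate (λ u → does (adj? G v u))

N[_] : Graph n → Fin n → Subset n
N[ G ] v = N G v ∪ ⁅ v ⁆

deg : Graph n → Fin n → ℕ
deg G v = ∣ N G v ∣

degrees : Graph n → List ℕ
degrees {n} G = mapᴸ (deg G) (allFin n)

Δ : Graph n → ℕ
Δ G = max 0 (degrees G)

-- Every degree is below n, so the default value n of the minimum is
-- never the result unless the graph is empty.
δ : Graph n → ℕ
δ {n} G = min n (degrees G)

NoIsolatedVertices : Graph n → Set
NoIsolatedVertices G = ∀ v → ∃ λ u → Adj G v u

-- The vertex (u , v) is represented in Fin (m * n) through the bijection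
-- remQuot n : Fin (m * n) → Fin m × Fin n.
infixr 9 _∘_

_∘_ : Graph m → Graph n → Graph (m * n)
_∘_ {m} {n} G H = record
  { Adj        = λ p q → LexAdj (remQuot n p) (remQuot n q)
  ; adj?       = λ p q → lexAdj? (remQuot n p) (remQuot n q)
  ; adj-sym    = λ {p} {q} → lex-sym (remQuot n p) (remQuot n q)
  ; adj-irrefl = λ { {p} refl → lex-irrefl (remQuot n p) }
  }
  where
  LexAdj : Rel (Fin m × Fin n) 0ℓ
  LexAdj (u , v) (x , y) = Adj G u x ⊎ (u ≡ x × Adj H v y)

  lexAdj? : Decidable₂ LexAdj
  lexAdj? (u , v) (x , y) = adj? G u x ⊎-dec ((u ≟ x) ×-dec adj? H v y)

  lex-sym : ∀ p q → LexAdj p q → LexAdj q p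
  lex-sym _ _ (inj₁ ux)       = inj₁ (adj-sym G ux)
  lex-sym _ _ (inj₂ (e , vy)) = inj₂ (sym e , adj-sym H vy)

  lex-irrefl : ∀ p → ¬ LexAdj p p
  lex-irrefl _ (inj₁ uu)       = adj-irrefl G refl uu
  lex-irrefl _ (inj₂ (_ , vv)) = adj-irrefl H refl vv

Dominating : Graph n → Subset n → Set
Dominating G S = ∀ v → v ∉ S → ∃ λ u → u ∈ S × Adj G v u

PerfectDominating : Graph n → Subset n → Set
PerfectDominating G S = ∀ v → v ∉ S → ∃! _≡_ λ u → u ∈ S × Adj G v u

TotalDominating : Graph n → Subset n → Set
TotalDominating G S = ∀ v → ∃ λ u → u ∈ S × Adj G v u

EfficientOpenDomination : Graph n → Set
EfficientOpenDomination G = ∃ λ D →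
  (∀ x → ∃ λ u → u ∈ D × x ∈ N G u) ×
  (∀ u v → u ∈ D → v ∈ D → u ≢ v → Empty (N G u ∩ N G v))

EfficientClosedDomination : Graph n → Set
EfficientClosedDomination G = ∃ λ S →
  Dominating G S ×
  (∀ u v → u ∈ S → v ∈ S → u ≢ v → Empty (N[ G ] u ∩ N[ G ] v))

-- A function V → {0,1,2}, given as the vector of its values.
Labelling : ℕ → Set
Labelling n = Vec (Fin 3) n

PerfectRomanDominating : Graph n → Labelling n → Set
PerfectRomanDominating G f =
  ∀ u → lookup f u ≡ 0F → ∃! _≡_ λ v → lookup f v ≡ 2F × Adj G u v

weight : Labelling n → ℕ
weight f = sum (map toℕ f)

private
  ∃!? : {P : Pred (Fin n) 0ℓ} → Decidable P → Dec (∃! _≡_ P)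
  ∃!? P? = map′
    (λ (x , px , uniq) → x , px , λ {y} → uniq y)
    (λ (x , px , uniq) → x , px , λ y → uniq {y})
    (any? λ x → P? x ×-dec all? λ y → P? y →-dec (x ≟ y))

dominating? : (G : Graph n) → Decidable (Dominating G)
dominating? G S = all? λ v →
  ¬? (v ∈? S) →-dec any? λ u → (u ∈? S) ×-dec adj? G v u

perfectDominating? : (G : Graph n) → Decidable (PerfectDominating G)
perfectDominating? G S = all? λ v →
  ¬? (v ∈? S) →-dec ∃!? λ u → (u ∈? S) ×-dec adj? G v u

totalDominating? : (G : Graph n) → Decidable (TotalDominating G)
totalDominating? G S = all? λ v → any? λ u → (u ∈? S) ×-dec adj? G v u

perfectRomanDominating? : (G : Graph n) → Decidable (PerfectRomanDominating G)
perfectRomanDominating? G f = all? λ u →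
  (lookup f u ≟ 0F) →-dec ∃!? λ v → (lookup f v ≟ 2F) ×-dec adj? G u v

anyLabelling? : {P : Pred (Labelling n) 0ℓ} → Decidable P → Dec (∃ P)
anyLabelling? {zero}  P? = map′ ([] ,_) (λ { ([] , p) → p }) (P? [])
anyLabelling? {suc n} P? = map′
  (λ (x , xs , p) → x ∷ xs , p)
  (λ { (x ∷ xs , p) → x , xs , p })
  (any? λ x → anyLabelling? λ xs → P? (x ∷ xs))

record IsMinimum {A : Set} (P : Pred A 0ℓ) (size : A → ℕ) (k : ℕ) : Set where
  field
    attained   : ∃ λ a → P a × size a ≡ k
    lowerBound : ∀ a → P a → k ≤ size a

open IsMinimum public

minimum : {A : Set} →
          ({Q : Pred A 0ℓ} → Decidable Q → Dec (∃ Q)) →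
          {P : Pred A 0ℓ} → Decidable P → (size : A → ℕ) →
          ∃ P → ∃ (IsMinimum P size)
minimum {A} any-A? {P} P? size (a , pa) = search 0 (size a) refl (λ _ _ → z≤n)
  where
  search : ∀ k d → k + d ≡ size a → (∀ b → P b → k ≤ size b) →
           ∃ (IsMinimum P size)
  search k d eq lb with any-A? (λ b → P? b ×-dec (size b ≟ᴺ k))
  ... | yes att = k , record { attained = att ; lowerBound = lb }
  search k zero    eq lb | no ¬att =
    ⊥-elim (¬att (a , pa , trans (sym eq) (+-identityʳ k)))
  search k (suc d) eq lb | no ¬att =
    search (suc k) d (trans (sym (+-suc k d)) eq)
      (λ b pb → ≤∧≢⇒< (lb b pb) (λ k≡ → ¬att (b , pb , sym k≡)))

γ-min : (G : Graph n) → ∃ (IsMinimum (Dominating G) ∣_∣)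
γ-min G = minimum anySubset? (dominating? G) ∣_∣
  (⊤ , λ v v∉⊤ → ⊥-elim (v∉⊤ ∈⊤))

γᵖ-min : (G : Graph n) → ∃ (IsMinimum (PerfectDominating G) ∣_∣)
γᵖ-min G = minimum anySubset? (perfectDominating? G) ∣_∣
  (⊤ , λ v v∉⊤ → ⊥-elim (v∉⊤ ∈⊤))

γᵗ-min : (G : Graph n) → NoIsolatedVertices G →
         ∃ (IsMinimum (TotalDominating G) ∣_∣)
γᵗ-min G noIso = minimum anySubset? (totalDominating? G) ∣_∣
  (⊤ , λ v → let (u , vu) = noIso v in u , ∈⊤ , vu)

γᵖᴿ-min : (G : Graph n) → ∃ (IsMinimum (PerfectRomanDominating G) weight)
γᵖᴿ-min {n} G = minimum anyLabelling? (perfectRomanDominating? G) weight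
  (replicate n 1F , λ u f[u]≡0 → ⊥-elim (1≢0 (trans (sym (lookup-replicate u 1F)) f[u]≡0)))
  where
  1≢0 : _≢_ {A = Fin 3} 1F 0F
  1≢0 ()

γ : Graph n → ℕ
γ G = proj₁ (γ-min G)

γᵖ : Graph n → ℕ
γᵖ G = proj₁ (γᵖ-min G)

γᵗ : (G : Graph n) → NoIsolatedVertices G → ℕ
γᵗ G noIso = proj₁ (γᵗ-min G noIso)

γᵖᴿ : Graph n → ℕ
γᵖᴿ G = proj₁ (γᵖᴿ-min G)

{-# OPTIONS --safe #-}
-- Lower bound: suppose c ≤ |V(H)|, c ≤ δ(H) + 2 and c ≤ |V(H)| − Δ(H) + 1.
-- For a perfect Roman dominating function f on G ∘ H, the vertices u of G
-- whose copy of H has weight at least c dominate G, so f has weight at least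
-- c γ(G).  Indeed, a light copy contains a zero, hence sees a unique vertex
-- (x , y) with value 2.  If x ≠ u, then copy x is heavy: either y is adjacent
-- to all zeros of its copy, or some zero of copy x is covered from another
-- copy, and then y has no zero among its own neighbours.  If x = u, then copy
-- u contains a second vertex with value 2, so every neighbouring copy is free
-- of zeros and hence heavy.
--
-- Upper bound: place a row with a single 2, at a vertex of maximum
-- (respectively minimum) degree of H, on the copies indexed by an efficient
-- dominating set of G.  Such a set is minimum, since each vertex of a
-- competing dominating set lies in exactly one of its neighbourhoods.
module Submission where

import Algebra.Properties.Semiring.Sum
open import Data.Bool using (true; false; if_then_else_)
open import Data.Empty using (⊥-elim)
open import Data.Fin using (Fin; zero; suc; toℕ; remQuot; combine; _↑ˡ_; _↑ʳ_; _≟_)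
open import Data.Fin.Patterns using (0F; 1F; 2F)
open import Data.Fin.Properties
  using (any?; all?; ¬∀⟶∃¬; remQuot-combine; combine-surjective; combine-injective)
open import Data.Fin.Subset using (Subset; _∈_; _∉_; _∩_; ⁅_⁆; ∣_∣; Empty)
open import Data.Fin.Subset.Properties
  using (_∈?_; x∈⁅x⁆; x≢y⇒x∉⁅y⁆; ∣⁅x⁆∣≡1; ∣p∣≤n; x∈p∩q⁺; x∈p∪q⁺)
open import Data.List.Extrema.Nat using (argmin-sel; argmax-sel; min≤xs; xs≤max)
open import Data.List.Membership.Propositional.Properties using (∈-map⁺; ∈-map⁻; ∈-allFin)
open import Data.List.Relation.Unary.All using () renaming (lookup to lookupᴬ)
open import Data.Nat using (ℕ; zero; suc; _+_; _*_; _∸_; _≤_; _<_; _≥_; z≤n; s≤s; _≤?_)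
open import Data.Nat.Properties hiding (_≟_)
open import Data.Product using (∃; ∃₂; ∃!; _×_; _,_; proj₁; proj₂)
open import Data.Sum using (_⊎_; inj₁; inj₂)
open import Data.Vec using ([]; _∷_; lookup; tabulate)
open import Data.Vec.Properties using ([]=⇒lookup; lookup⇒[]=; lookup∘tabulate)
open import Relation.Binary.PropositionalEquality
  using (_≡_; _≢_; refl; sym; trans; cong; cong₂; subst; module ≡-Reasoning)
open import Relation.Nullary using (Dec; yes; no; does; ¬_; contradiction)
open import Relation.Nullary.Decidable using (_→-dec_; dec-true)

open import Defs

open Algebra.Properties.Semiring.Sum +-*-semiring
  using (sum; sum-syntax; sum-cong-≗; ∑-distrib-+; ∑-comm; *-distribˡ-sum; *-distribʳ-sum)

private variable
  m n : ℕ

-- Sums and cardinalities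

∑-mono : {f g : Fin n → ℕ} → (∀ i → f i ≤ g i) → sum f ≤ sum g
∑-mono {zero}  f≤g = z≤n
∑-mono {suc n} f≤g = +-mono-≤ (f≤g zero) (∑-mono (λ i → f≤g (suc i)))

∑-const-1 : ∀ n → ∑[ i < n ] 1 ≡ n
∑-const-1 zero    = refl
∑-const-1 (suc n) = cong suc (∑-const-1 n)

term≤∑ : (f : Fin n → ℕ) → ∀ i → f i ≤ sum f
term≤∑ f zero    = m≤m+n _ _
term≤∑ f (suc i) = ≤-trans (term≤∑ (λ j → f (suc j)) i) (m≤n+m _ _)

∑-++ : ∀ m (f : Fin (m + n) → ℕ) →
       sum f ≡ ∑[ i < m ] f (i ↑ˡ n) + ∑[ j < n ] f (m ↑ʳ j)
∑-++ zero    f = refl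
∑-++ (suc m) f = trans (cong (f zero +_) (∑-++ m (λ i → f (suc i))))
                       (sym (+-assoc (f zero) _ _))

∑-combine : ∀ m (f : Fin (m * n) → ℕ) →
            sum f ≡ ∑[ i < m ] ∑[ j < n ] f (combine i j)
∑-combine         zero    f = refl
∑-combine {n = n} (suc m) f = trans (∑-++ n f)
  (cong (∑[ j < n ] f (j ↑ˡ (m * n)) +_) (∑-combine m (λ i → f (n ↑ʳ i))))

χ : Subset n → Fin n → ℕ
χ p i = if lookup p i then 1 else 0

χ-∈ : {p : Subset n} {i : Fin n} → i ∈ p → χ p i ≡ 1
χ-∈ i∈p rewrite []=⇒lookup i∈p = refl

χ-∉ : {p : Subset n} {i : Fin n} → i ∉ p → χ p i ≡ 0
χ-∉ {p = p} {i} i∉p with lookup p i in eq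
... | true  = contradiction (lookup⇒[]= i p eq) i∉p
... | false = refl

∣p∣≡∑χ : (p : Subset n) → ∣ p ∣ ≡ sum (χ p)
∣p∣≡∑χ []          = refl
∣p∣≡∑χ (true ∷ p)  = cong suc (∣p∣≡∑χ p)
∣p∣≡∑χ (false ∷ p) = ∣p∣≡∑χ p

∑χ⁅_⁆≡1 : (i : Fin n) → sum (χ ⁅ i ⁆) ≡ 1
∑χ⁅ i ⁆≡1 = trans (sym (∣p∣≡∑χ ⁅ i ⁆)) (∣⁅x⁆∣≡1 i)

-- Double counting of the pairs (`t` , `u`) with `t` in `q` and `φ t ≡ u`: every `u` in `p` occurs
-- in at least one of them, every `t` in `q` in exactly one.
⊆image⇒∣p∣≤∣q∣ : (p q : Subset n) (φ : Fin n → Fin n) →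
                (∀ u → u ∈ p → ∃ λ t → t ∈ q × φ t ≡ u) → ∣ p ∣ ≤ ∣ q ∣
⊆image⇒∣p∣≤∣q∣ {n} p q φ cover = begin
  ∣ p ∣                                           ≡⟨ ∣p∣≡∑χ p ⟩
  ∑[ u < n ] χ p u                                ≤⟨ ∑-mono pointwise ⟩
  ∑[ u < n ] ∑[ t < n ] (χ q t * χ ⁅ φ t ⁆ u)     ≡⟨ ∑-comm (λ u t → χ q t * χ ⁅ φ t ⁆ u) ⟩
  ∑[ t < n ] ∑[ u < n ] (χ q t * χ ⁅ φ t ⁆ u)     ≡⟨ sum-cong-≗ collapse ⟩
  ∑[ t < n ] χ q t                                ≡⟨ ∣p∣≡∑χ q ⟨
  ∣ q ∣                                           ∎
  where
  open ≤-Reasoning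

  pointwise : ∀ u → χ p u ≤ ∑[ t < n ] (χ q t * χ ⁅ φ t ⁆ u)
  pointwise u with u ∈? p
  ... | no u∉p  = ≤-trans (≤-reflexive (χ-∉ u∉p)) z≤n
  ... | yes u∈p with (t , t∈q , refl) ← cover u u∈p = begin
    χ p (φ t)                              ≡⟨ χ-∈ u∈p ⟩
    1                                      ≡⟨ cong₂ _*_ (χ-∈ t∈q) (χ-∈ (x∈⁅x⁆ (φ t))) ⟨
    χ q t * χ ⁅ φ t ⁆ (φ t)                ≤⟨ term≤∑ (λ s → χ q s * χ ⁅ φ s ⁆ (φ t)) t ⟩
    ∑[ s < n ] (χ q s * χ ⁅ φ s ⁆ (φ t))   ∎

  collapse : ∀ t → ∑[ u < n ] (χ q t * χ ⁅ φ t ⁆ u) ≡ χ q t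
  collapse t = trans (sym (*-distribˡ-sum (χ q t) (χ ⁅ φ t ⁆)))
                     (trans (cong (χ q t *_) ∑χ⁅ φ t ⁆≡1) (*-identityʳ _))

weight≡∑ : (f : Labelling n) → weight f ≡ ∑[ i < n ] toℕ (lookup f i)
weight≡∑ []      = refl
weight≡∑ (x ∷ f) = cong (toℕ x +_) (weight≡∑ f)

weight≡∑∑ : ∀ m (f : Labelling (m * n)) →
            weight f ≡ ∑[ u < m ] ∑[ v < n ] toℕ (lookup f (combine u v))
weight≡∑∑ m f = trans (weight≡∑ f) (∑-combine m (λ p → toℕ (lookup f p)))

-- Degrees

does-true : {A : Set} (a? : Dec A) → does a? ≡ true → A
does-true (yes a) refl = a

∈N⁺ : (G : Graph n) {u v : Fin n} → Adj G v u → u ∈ N G v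
∈N⁺ G {u} {v} vu =
  lookup⇒[]= u _ (trans (lookup∘tabulate _ u) (dec-true (adj? G v u) vu))

∈N⁻ : (G : Graph n) {u v : Fin n} → u ∈ N G v → Adj G v u
∈N⁻ G {u} {v} u∈N =
  does-true (adj? G v u) (trans (sym (lookup∘tabulate _ u)) ([]=⇒lookup u∈N))

χN≡1 : (G : Graph n) {u v : Fin n} → Adj G v u → χ (N G v) u ≡ 1
χN≡1 G vu = χ-∈ (∈N⁺ G vu)

χN≡0 : (G : Graph n) {u v : Fin n} → ¬ Adj G v u → χ (N G v) u ≡ 0
χN≡0 G ¬vu = χ-∉ (λ u∈N → ¬vu (∈N⁻ G u∈N))

χ⁅x⁆≡1 : (x : Fin n) → χ ⁅ x ⁆ x ≡ 1
χ⁅x⁆≡1 x = χ-∈ (x∈⁅x⁆ x)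

χ⁅y⁆≡0 : {x y : Fin n} → x ≢ y → χ ⁅ y ⁆ x ≡ 0
χ⁅y⁆≡0 x≢y = χ-∉ (x≢y⇒x∉⁅y⁆ x≢y)

deg≤Δ : (G : Graph n) → ∀ v → deg G v ≤ Δ G
deg≤Δ G v = lookupᴬ (xs≤max 0 (degrees G)) (∈-map⁺ (deg G) (∈-allFin v))

δ≤deg : (G : Graph n) → ∀ v → δ G ≤ deg G v
δ≤deg {n} G v = lookupᴬ (min≤xs n (degrees G)) (∈-map⁺ (deg G) (∈-allFin v))

Δ-attained : (G : Graph n) → Fin n → ∃ λ h → deg G h ≡ Δ G
Δ-attained G v with argmax-sel (λ d → d) 0 (degrees G)
... | inj₁ Δ≡0 = v , ≤-antisym (deg≤Δ G v) (≤-trans (≤-reflexive Δ≡0) z≤n)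
... | inj₂ Δ∈  with (h , _ , Δ≡) ← ∈-map⁻ (deg G) Δ∈ = h , sym Δ≡

δ-attained : (G : Graph n) → Fin n → ∃ λ h → deg G h ≡ δ G
δ-attained {n} G v with argmin-sel (λ d → d) n (degrees G)
-- If the minimum is the default `n`, then `n ≤ deg G v ≤ n`, so the given vertex attains it.
... | inj₁ δ≡n = v , ≤-antisym (≤-trans (∣p∣≤n (N G v)) (≤-reflexive (sym δ≡n))) (δ≤deg G v)
... | inj₂ δ∈  with (h , _ , δ≡) ← ∈-map⁻ (deg G) δ∈ = h , sym δ≡

-- Weights of single rows

rowWeight : (Fin n → Fin 3) → ℕ
rowWeight {n} g = ∑[ j < n ] toℕ (g j)

≢0F⇒1≤ : {x : Fin 3} → x ≢ 0F → 1 ≤ toℕ x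
≢0F⇒1≤ {0F}    x≢0 = contradiction refl x≢0
≢0F⇒1≤ {suc _} _   = s≤s z≤n

noZeros⇒n≤weight : (g : Fin n → Fin 3) → (∀ j → g j ≢ 0F) → n ≤ rowWeight g
noZeros⇒n≤weight {n} g g≢0 = begin
  n             ≡⟨ ∑-const-1 n ⟨
  ∑[ j < n ] 1  ≤⟨ ∑-mono (λ j → ≢0F⇒1≤ (g≢0 j)) ⟩
  rowWeight g   ∎
  where open ≤-Reasoning

∑-2χ⁅h⁆+χN : (H : Graph n) (h : Fin n) →
             ∑[ j < n ] (2 * χ ⁅ h ⁆ j + χ (N H h) j) ≡ 2 + deg H h
∑-2χ⁅h⁆+χN H h = trans (∑-distrib-+ (λ j → 2 * χ ⁅ h ⁆ j) (χ (N H h)))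
  (cong₂ _+_ (trans (sym (*-distribˡ-sum 2 (χ ⁅ h ⁆))) (cong (2 *_) ∑χ⁅ h ⁆≡1))
             (sym (∣p∣≡∑χ (N H h))))

∑-1+χ⁅h⁆ : (h : Fin n) → ∑[ j < n ] (1 + χ ⁅ h ⁆ j) ≡ suc n
∑-1+χ⁅h⁆ {n} h = trans (∑-distrib-+ (λ _ → 1) (χ ⁅ h ⁆))
  (trans (cong₂ _+_ (∑-const-1 n) ∑χ⁅ h ⁆≡1) (+-comm n 1))

∑-row+χN : (H : Graph n) (h : Fin n) (g : Fin n → Fin 3) →
           ∑[ j < n ] (toℕ (g j) + χ (N H h) j) ≡ rowWeight g + deg H h
∑-row+χN H h g = trans (∑-distrib-+ (λ j → toℕ (g j)) (χ (N H h)))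
  (cong (rowWeight g +_) (sym (∣p∣≡∑χ (N H h))))

-- The value 2 at `h` and at least 1 at each of its neighbours already give this much.
nonzeroNeighbours⇒2+deg≤weight : (H : Graph n) (g : Fin n → Fin 3) (h : Fin n) → g h ≡ 2F →
  (∀ j → Adj H h j → g j ≢ 0F) → 2 + deg H h ≤ rowWeight g
nonzeroNeighbours⇒2+deg≤weight {n} H g h gh≡2 nz = begin
  2 + deg H h                               ≡⟨ ∑-2χ⁅h⁆+χN H h ⟨
  ∑[ j < n ] (2 * χ ⁅ h ⁆ j + χ (N H h) j)  ≤⟨ ∑-mono pointwise ⟩
  rowWeight g                               ∎
  where
  open ≤-Reasoning

  pointwise : ∀ j → 2 * χ ⁅ h ⁆ j + χ (N H h) j ≤ toℕ (g j)
  pointwise j with j ≟ h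
  ... | yes refl rewrite χ⁅x⁆≡1 j | χN≡0 H {j} {j} (adj-irrefl H refl) | gh≡2 = ≤-refl
  ... | no j≢h rewrite χ⁅y⁆≡0 j≢h with adj? H h j
  ...   | yes hj rewrite χN≡1 H hj  = ≢0F⇒1≤ (nz j hj)
  ...   | no ¬hj rewrite χN≡0 H ¬hj = z≤n

-- Raising the row by 1 on the neighbourhood of `h` leaves no zero, and `h` itself still counts 2.
-- The additive form avoids a truncated subtraction.
zerosAdjacent⇒n<weight+deg : (H : Graph n) (g : Fin n → Fin 3) (h : Fin n) → g h ≡ 2F →
  (∀ j → g j ≡ 0F → Adj H h j) → n < rowWeight g + deg H h
zerosAdjacent⇒n<weight+deg {n} H g h gh≡2 adj = begin
  suc n                                 ≡⟨ ∑-1+χ⁅h⁆ h ⟨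
  ∑[ j < n ] (1 + χ ⁅ h ⁆ j)            ≤⟨ ∑-mono pointwise ⟩
  ∑[ j < n ] (toℕ (g j) + χ (N H h) j)  ≡⟨ ∑-row+χN H h g ⟩
  rowWeight g + deg H h                 ∎
  where
  open ≤-Reasoning

  pointwise : ∀ j → 1 + χ ⁅ h ⁆ j ≤ toℕ (g j) + χ (N H h) j
  pointwise j with j ≟ h
  ... | yes refl rewrite χ⁅x⁆≡1 j | gh≡2 = m≤m+n 2 _
  ... | no j≢h rewrite χ⁅y⁆≡0 j≢h with g j ≟ 0F
  ...   | yes gj≡0 rewrite gj≡0 | χN≡1 H (adj j gj≡0) = ≤-refl
  ...   | no gj≢0 = ≤-trans (≢0F⇒1≤ gj≢0) (m≤m+n _ _)

-- Rows with a single value 2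

record Row (H : Graph n) : Set where
  field
    value  : Fin n → Fin 3
    centre : Fin n
    two    : value centre ≡ 2F
    unique : ∀ j → value j ≡ 2F → j ≡ centre

open Row

centredRow : (H : Graph n) → Fin n → (inside outside : Fin 3) → Fin n → Fin 3
centredRow H h a b j =
  if does (j ≟ h) then 2F else if does (adj? H h j) then a else b

row : (H : Graph n) → Fin n → (a b : Fin 3) → a ≢ 2F → b ≢ 2F → Row H
row H h a b a≢2 b≢2 = record
  { value  = centredRow H h a b
  ; centre = h
  ; two    = at-centre
  ; unique = only-centre
  }
  where
  at-centre : centredRow H h a b h ≡ 2F
  at-centre rewrite dec-true (h ≟ h) refl = refl

  only-centre : ∀ j → centredRow H h a b j ≡ 2F → j ≡ h
  only-centre j eq with j ≟ h
  ... | yes j≡h = j≡h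
  ... | no _ with adj? H h j
  ...   | yes _ = contradiction eq a≢2
  ...   | no _  = contradiction eq b≢2

-- The zeros of `rowᵐᵃˣ` are the neighbours of `h`, which `h` covers within the copy; a large degree
-- of `h` makes this row light. The zeros of `rowᵐⁱⁿ` are the vertices other than `h` not adjacent
-- to `h`, to be covered from another copy; here a small degree makes the row light.
rowᵐᵃˣ rowᵐⁱⁿ : (H : Graph n) → Fin n → Row H
rowᵐᵃˣ H h = row H h 0F 1F (λ ()) (λ ())
rowᵐⁱⁿ H h = row H h 1F 0F (λ ()) (λ ())

rowᵐᵃˣ-zero : (H : Graph n) (h j : Fin n) → value (rowᵐᵃˣ H h) j ≡ 0F → Adj H h j
rowᵐᵃˣ-zero H h j eq with j ≟ h
rowᵐᵃˣ-zero H h j () | yes _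
rowᵐᵃˣ-zero H h j eq | no _ with adj? H h j
rowᵐᵃˣ-zero H h j eq | no _ | yes hj = hj
rowᵐᵃˣ-zero H h j () | no _ | no _

rowᵐⁱⁿ-zero : (H : Graph n) (h j : Fin n) → value (rowᵐⁱⁿ H h) j ≡ 0F → ¬ Adj H h j
rowᵐⁱⁿ-zero H h j eq with j ≟ h
rowᵐⁱⁿ-zero H h j () | yes _
rowᵐⁱⁿ-zero H h j eq | no _ with adj? H h j
rowᵐⁱⁿ-zero H h j () | no _ | yes _
rowᵐⁱⁿ-zero H h j eq | no _ | no ¬hj = ¬hj

rowᵐᵃˣ-weight : (H : Graph n) (h : Fin n) →
                rowWeight (value (rowᵐᵃˣ H h)) + deg H h ≡ suc n
rowᵐᵃˣ-weight H h = trans (sym (∑-row+χN H h (value (rowᵐᵃˣ H h))))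
  (trans (sum-cong-≗ pointwise) (∑-1+χ⁅h⁆ h))
  where
  pointwise : ∀ j → toℕ (value (rowᵐᵃˣ H h) j) + χ (N H h) j ≡ 1 + χ ⁅ h ⁆ j
  pointwise j with j ≟ h
  ... | yes refl rewrite χ⁅x⁆≡1 j | χN≡0 H {j} {j} (adj-irrefl H refl) = refl
  ... | no j≢h rewrite χ⁅y⁆≡0 j≢h with adj? H h j
  ...   | yes hj rewrite χN≡1 H hj  = refl
  ...   | no ¬hj rewrite χN≡0 H ¬hj = refl

rowᵐⁱⁿ-weight : (H : Graph n) (h : Fin n) →
                rowWeight (value (rowᵐⁱⁿ H h)) ≡ 2 + deg H h
rowᵐⁱⁿ-weight H h = trans (sum-cong-≗ pointwise) (∑-2χ⁅h⁆+χN H h)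
  where
  pointwise : ∀ j → toℕ (value (rowᵐⁱⁿ H h) j) ≡ 2 * χ ⁅ h ⁆ j + χ (N H h) j
  pointwise j with j ≟ h
  ... | yes refl rewrite χ⁅x⁆≡1 j | χN≡0 H {j} {j} (adj-irrefl H refl) = refl
  ... | no j≢h rewrite χ⁅y⁆≡0 j≢h with adj? H h j
  ...   | yes hj rewrite χN≡1 H hj  = refl
  ...   | no ¬hj rewrite χN≡0 H ¬hj = refl

-- Adjacency in G ∘ H in terms of pairs of vertices

LexAdj : Graph m → Graph n → Fin m × Fin n → Fin m × Fin n → Set
LexAdj G H (u , v) (x , y) = Adj G u x ⊎ (u ≡ x × Adj H v y)

module _ (G : Graph m) (H : Graph n) where

  -- An equality of types, so that adjacency proofs can be moved by `subst` in both directions. Both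
  -- relations unfold on pairs by eta, which leaves only `remQuot` of `combine` to rewrite.
  adj-combine : ∀ u v x y →
    Adj (G ∘ H) (combine u v) (combine x y) ≡ LexAdj G H (u , v) (x , y)
  adj-combine u v x y =
    cong₂ (LexAdj G H) (remQuot-combine u v) (remQuot-combine x y)

  roman-combine : (f : Labelling (m * n)) → PerfectRomanDominating (G ∘ H) f →
    ∀ u v → lookup f (combine u v) ≡ 0F →
    ∃₂ λ x y → lookup f (combine x y) ≡ 2F × LexAdj G H (u , v) (x , y) ×
      (∀ {a b} → lookup f (combine a b) ≡ 2F → LexAdj G H (u , v) (a , b) →
        x ≡ a × y ≡ b)
  roman-combine f prd u v fuv≡0
    with (q , (fq≡2 , uv∼q) , uniq) ← prd (combine u v) fuv≡0
    with (x , y , refl) ← combine-surjective {m} {n} q =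
      x , y , fq≡2 , subst (λ A → A) (adj-combine u v x y) uv∼q ,
      λ {a} {b} fab≡2 uv∼ab → combine-injective x y a b
        (uniq (fab≡2 , subst (λ A → A) (sym (adj-combine u v a b)) uv∼ab))

  -- Labellings that repeat one row on the copies indexed by a set

  blowUp : Subset m → Row H → Labelling (m * n)
  blowUp S r = tabulate λ p →
    if lookup S (proj₁ (remQuot {m} n p)) then value r (proj₂ (remQuot {m} n p)) else 0F

  lookup-blowUp : ∀ S r u v →
    lookup (blowUp S r) (combine u v) ≡ (if lookup S u then value r v else 0F)
  lookup-blowUp S r u v = trans (lookup∘tabulate _ (combine u v))
    (cong (λ p → if lookup S (proj₁ p) then value r (proj₂ p) else 0F) (remQuot-combine u v))

  weight-blowUp : ∀ S r → weight (blowUp S r) ≡ ∣ S ∣ * rowWeight (value r)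
  weight-blowUp S r = begin
    weight (blowUp S r)
      ≡⟨ weight≡∑∑ m (blowUp S r) ⟩
    ∑[ u < m ] ∑[ v < n ] toℕ (lookup (blowUp S r) (combine u v))
      ≡⟨ sum-cong-≗ (λ u → trans (sum-cong-≗ (λ v → cong toℕ (lookup-blowUp S r u v)))
                                 (row-sum (lookup S u))) ⟩
    ∑[ u < m ] (χ S u * rowWeight (value r))
      ≡⟨ *-distribʳ-sum (rowWeight (value r)) (χ S) ⟨
    sum (χ S) * rowWeight (value r)
      ≡⟨ cong (_* rowWeight (value r)) (∣p∣≡∑χ S) ⟨
    ∣ S ∣ * rowWeight (value r) ∎
    where
    open ≡-Reasoning

    row-sum : ∀ b → ∑[ v < n ] toℕ (if b then value r v else 0F)
                  ≡ (if b then 1 else 0) * rowWeight (value r)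
    row-sum true  = sym (+-identityʳ _)
    row-sum false = trans (sym (*-distribʳ-sum {n} 0 (λ _ → 0))) (*-zeroʳ (sum {n} (λ _ → 0)))

  blowUp-zero : ∀ S r u v → lookup (blowUp S r) (combine u v) ≡ 0F → u ∉ S ⊎ value r v ≡ 0F
  blowUp-zero S r u v eq rewrite lookup-blowUp S r u v with lookup S u in u∈?S
  ... | true  = inj₂ eq
  ... | false = inj₁ λ u∈S → contradiction (trans (sym u∈?S) ([]=⇒lookup u∈S)) λ ()

  blowUp-two : ∀ S r u v → lookup (blowUp S r) (combine u v) ≡ 2F → u ∈ S × v ≡ centre r
  blowUp-two S r u v eq rewrite lookup-blowUp S r u v with lookup S u in u∈?S
  blowUp-two S r u v eq | true  = lookup⇒[]= u S u∈?S , unique r v eq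
  blowUp-two S r u v () | false

  -- Every value 2 of a blow-up sits at the centre of the row in a copy from `S`, so existence and
  -- uniqueness concern only the choice of the copy `x`.
  blowUp-roman : ∀ S r →
    (∀ u v → u ∉ S ⊎ value r v ≡ 0F →
      ∃! _≡_ λ x → x ∈ S × LexAdj G H (u , v) (x , centre r)) →
    PerfectRomanDominating (G ∘ H) (blowUp S r)
  blowUp-roman S r cover p fp≡0 with combine-surjective {m} {n} p
  ... | u , v , refl
    with (x , (x∈S , uv∼x) , uniq) ←
      cover u v (blowUp-zero S r u v fp≡0) =
    combine x (centre r) ,
    ( trans (lookup-blowUp S r x (centre r))
        (trans (cong (λ b → if b then value r (centre r) else 0F) ([]=⇒lookup x∈S)) (two r))
    , subst (λ A → A) (sym (adj-combine u v x (centre r))) uv∼x ) ,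
    λ {q} → unique-two q
    where
    unique-two : ∀ q → lookup (blowUp S r) q ≡ 2F × Adj (G ∘ H) (combine u v) q →
                 combine x (centre r) ≡ q
    unique-two q (fq≡2 , uv∼q) with combine-surjective {m} {n} q
    ... | a , b , refl
      with (a∈S , refl) ← blowUp-two S r a b fq≡2 =
      cong (λ z → combine z b) (uniq (a∈S , subst (λ A → A) (adj-combine u v a b) uv∼q))

-- The lower bound

module LowerBound (G : Graph m) (noIso : NoIsolatedVertices G) (H : Graph n) (c : ℕ)
                  (c≤n : c ≤ n)
                  (c≤2+deg : ∀ y → c ≤ 2 + deg H y)
                  (c+deg≤1+n : ∀ y → c + deg H y ≤ suc n)
                  (f : Labelling (m * n)) (prd : PerfectRomanDominating (G ∘ H) f)
                  where

  F : Fin m → Fin n → Fin 3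
  F u v = lookup f (combine u v)

  heavy : Subset m
  heavy = tabulate λ u → does (c ≤? rowWeight (F u))

  heavy⁺ : ∀ {u} → c ≤ rowWeight (F u) → u ∈ heavy
  heavy⁺ {u} c≤ = lookup⇒[]= u _ (trans (lookup∘tabulate _ u) (dec-true (c ≤? _) c≤))

  heavy⁻ : ∀ {u} → u ∈ heavy → c ≤ rowWeight (F u)
  heavy⁻ {u} u∈ = does-true (c ≤? _) (trans (sym (lookup∘tabulate _ u)) ([]=⇒lookup u∈))

  -- Each of the three hypotheses on `c` serves one of the three criteria for heaviness that start
  -- here: no zero in the copy, a 2 adjacent to all its zeros, a 2 with no zero among its neighbours
  -- in the copy.
  noZeros⇒heavy : ∀ u → (∀ v → F u v ≢ 0F) → u ∈ heavy
  noZeros⇒heavy u nz = heavy⁺ (≤-trans c≤n (noZeros⇒n≤weight (F u) nz))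

  zerosAdjacent⇒heavy : ∀ u y → F u y ≡ 2F → (∀ z → F u z ≡ 0F → Adj H y z) → u ∈ heavy
  zerosAdjacent⇒heavy u y Fuy≡2 adj = heavy⁺ (+-cancelʳ-≤ (deg H y) _ _
    (≤-trans (c+deg≤1+n y) (zerosAdjacent⇒n<weight+deg H (F u) y Fuy≡2 adj)))

  nonzeroNeighbours⇒heavy : ∀ u y → F u y ≡ 2F → (∀ z → Adj H y z → F u z ≢ 0F) → u ∈ heavy
  nonzeroNeighbours⇒heavy u y Fuy≡2 nz = heavy⁺
    (≤-trans (c≤2+deg y) (nonzeroNeighbours⇒2+deg≤weight H (F u) y Fuy≡2 nz))

  -- The source of the contradictions below: a zero that sees a 2 in two places identifies them.
  same-two : ∀ {u v x y a b} → F u v ≡ 0F →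
             F x y ≡ 2F → LexAdj G H (u , v) (x , y) →
             F a b ≡ 2F → LexAdj G H (u , v) (a , b) → x ≡ a × y ≡ b
  same-two {u} {v} Fuv≡0 Fxy≡2 uv∼xy Fab≡2 uv∼ab
    with (_ , _ , _ , _ , uniq) ← roman-combine G H f prd u v Fuv≡0
    with (refl , refl) ← uniq Fxy≡2 uv∼xy = uniq Fab≡2 uv∼ab

  zerosAdjacent-or-not : ∀ u y → (∀ z → F u z ≡ 0F → Adj H y z) ⊎
                                 (∃ λ z → F u z ≡ 0F × ¬ Adj H y z)
  zerosAdjacent-or-not u y with all? (λ z → (F u z ≟ 0F) →-dec adj? H y z)
  ... | yes all = inj₁ all
  ... | no ¬all with (z , ¬z) ← ¬∀⟶∃¬ n _ (λ z → (F u z ≟ 0F) →-dec adj? H y z) ¬all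
                with F u z ≟ 0F
  ...   | yes Fuz≡0 = inj₂ (z , Fuz≡0 , λ yz → ¬z (λ _ → yz))
  ...   | no Fuz≢0  = contradiction (λ Fuz≡0 → contradiction Fuz≡0 Fuz≢0) ¬z

  coveredFromOutside⇒heavy : ∀ {u v x y} → F u v ≡ 0F → F x y ≡ 2F → Adj G u x → x ∈ heavy
  coveredFromOutside⇒heavy {u} {v} {x} {y} Fuv≡0 Fxy≡2 ux with zerosAdjacent-or-not x y
  ... | inj₁ adj = zerosAdjacent⇒heavy x y Fxy≡2 adj
  ... | inj₂ (z , Fxz≡0 , ¬yz) with roman-combine G H f prd x z Fxz≡0
  ...   | .x , b , Fxb≡2 , inj₂ (refl , zb) , _
        -- As `u` and `x` are adjacent, (`u` , `v`) sees all of copy `x`, in particular both (`x` ,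
        -- `y`) and (`x` , `b`). Hence `b` is `y`, although `z` is adjacent to `b` and not to `y`.
        with (_ , refl) ← same-two {v = v} Fuv≡0 Fxy≡2 (inj₁ ux) Fxb≡2 (inj₁ ux)
        = contradiction (adj-sym H zb) ¬yz
  -- The vertex (`a` , `b`) is seen from all of copy `x`. A zero neighbour (`x` , `t`) of (`x` ,
  -- `y`) would see both, forcing `x ≡ a`.
  ...   | a , b , Fab≡2 , inj₁ xa , _ = nonzeroNeighbours⇒heavy x y Fxy≡2 λ t yt Fxt≡0 →
          adj-irrefl G (proj₁ (same-two Fxt≡0 Fxy≡2 (inj₂ (refl , adj-sym H yt))
                                        Fab≡2 (inj₁ xa))) xa

  coveredFromInside⇒heavyNeighbour : ∀ {u v y} → u ∉ heavy →
    F u v ≡ 0F → F u y ≡ 2F → Adj H v y → ∃ λ t → t ∈ heavy × Adj G u t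
  coveredFromInside⇒heavyNeighbour {u} {v} {y} u∉ Fuv≡0 Fuy≡2 vy with zerosAdjacent-or-not u y
  ... | inj₁ adj = contradiction (zerosAdjacent⇒heavy u y Fuy≡2 adj) u∉
  ... | inj₂ (z , Fuz≡0 , ¬yz) with roman-combine G H f prd u z Fuz≡0
  -- A 2 in a neighbouring copy would also be seen by (`u` , `v`), next to (`u` , `y`).
  ...   | a , b , Fab≡2 , inj₁ ua , _ = ⊥-elim
          (adj-irrefl G (proj₁ (same-two Fuv≡0 Fuy≡2 (inj₂ (refl , vy)) Fab≡2 (inj₁ ua))) ua)
  -- Now `b` differs from `y`, since only `b` is adjacent to `z`. Copy `u` thus contains two values
  -- 2, and a zero in any neighbouring copy would see both; `noIso` supplies such a copy.
  ...   | .u , b , Fub≡2 , inj₂ (refl , zb) , _ with (t , ut) ← noIso u =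
          t , noZeros⇒heavy t t-noZeros , ut
    where
    t-noZeros : ∀ w → F t w ≢ 0F
    t-noZeros w Ftw≡0
      with (_ , refl) ← same-two Ftw≡0 Fuy≡2 (inj₁ (adj-sym G ut)) Fub≡2 (inj₁ (adj-sym G ut))
      = ¬yz (adj-sym H zb)

  heavy-dominating : Dominating G heavy
  heavy-dominating u u∉ with any? (λ v → F u v ≟ 0F)
  ... | no noZero = contradiction (noZeros⇒heavy u (λ v Fuv≡0 → noZero (v , Fuv≡0))) u∉
  ... | yes (v , Fuv≡0) with roman-combine G H f prd u v Fuv≡0
  ...   | x , y , Fxy≡2 , inj₁ ux , _ = x , coveredFromOutside⇒heavy Fuv≡0 Fxy≡2 ux , ux
  ...   | .u , y , Fuy≡2 , inj₂ (refl , vy) , _ =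
          coveredFromInside⇒heavyNeighbour u∉ Fuv≡0 Fuy≡2 vy

  γ*c≤weight : γ G * c ≤ weight f
  γ*c≤weight = begin
    γ G * c                       ≤⟨ *-monoˡ-≤ c (lowerBound (proj₂ (γ-min G)) heavy heavy-dominating) ⟩
    ∣ heavy ∣ * c                 ≡⟨ cong (_* c) (∣p∣≡∑χ heavy) ⟩
    sum (χ heavy) * c             ≡⟨ *-distribʳ-sum c (χ heavy) ⟩
    ∑[ u < m ] (χ heavy u * c)    ≤⟨ ∑-mono pointwise ⟩
    ∑[ u < m ] rowWeight (F u)    ≡⟨ weight≡∑∑ m f ⟨
    weight f                      ∎
    where
    open ≤-Reasoning

    pointwise : ∀ u → χ heavy u * c ≤ rowWeight (F u)
    pointwise u with u ∈? heavy
    ... | yes u∈ rewrite χ-∈ u∈ | +-identityʳ c = heavy⁻ u∈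
    ... | no u∉  rewrite χ-∉ u∉ = z≤n

-- Efficient dominating sets

disjoint⇒unique : {S : Subset n} (M : Fin n → Subset n) →
  (∀ u v → u ∈ S → v ∈ S → u ≢ v → Empty (M u ∩ M v)) →
  ∀ {u v t} → u ∈ S → v ∈ S → t ∈ M u → t ∈ M v → u ≡ v
disjoint⇒unique M disj {u} {v} {t} u∈S v∈S t∈Mu t∈Mv with u ≟ v
... | yes u≡v = u≡v
... | no u≢v  = ⊥-elim (disj u v u∈S v∈S u≢v (t , x∈p∩q⁺ (t∈Mu , t∈Mv)))

-- Let `φ` send a vertex to the only member of `S` whose closed neighbourhood contains it. A
-- dominating set `T` meets the closed neighbourhood of each `u` in `S`, in `u` itself or in a
-- dominator of `u`, so `φ` maps `T` onto `S`.
efficientClosed⇒minimum : (G : Graph m) ((S , _) : EfficientClosedDomination G) → ∣ S ∣ ≡ γ G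
efficientClosed⇒minimum {m} G (S , dom , disj) = ≤-antisym
  (let (T , domT , ∣T∣≡γ) = attained (proj₂ (γ-min G)) in
   ≤-trans (⊆image⇒∣p∣≤∣q∣ S T φ (covered T domT)) (≤-reflexive ∣T∣≡γ))
  (lowerBound (proj₂ (γ-min G)) S dom)
  where
  self : ∀ v → v ∈ N[ G ] v
  self v = x∈p∪q⁺ (inj₂ (x∈⁅x⁆ v))

  dominator : ∀ t → ∃ λ u → u ∈ S × t ∈ N[ G ] u
  dominator t with t ∈? S
  ... | yes t∈S = t , t∈S , self t
  ... | no t∉S with (u , u∈S , tu) ← dom t t∉S =
    u , u∈S , x∈p∪q⁺ (inj₁ (∈N⁺ G (adj-sym G tu)))

  φ : Fin m → Fin m
  φ t = proj₁ (dominator t)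

  φ-unique : ∀ u t → u ∈ S → t ∈ N[ G ] u → φ t ≡ u
  φ-unique u t u∈S t∈Nu with (w , w∈S , t∈Nw) ← dominator t =
    disjoint⇒unique N[ G ] disj w∈S u∈S t∈Nw t∈Nu

  covered : ∀ T → Dominating G T → ∀ u → u ∈ S → ∃ λ t → t ∈ T × φ t ≡ u
  covered T domT u u∈S with u ∈? T
  ... | yes u∈T = u , u∈T , φ-unique u u u∈S (self u)
  ... | no u∉T with (t , t∈T , ut) ← domT u u∉T =
    t , t∈T , φ-unique u t u∈S (x∈p∪q⁺ (inj₁ (∈N⁺ G ut)))

-- The comparison is with total dominating sets: `T` has to meet the open neighbourhood of every `u`
-- in `D`, also when `u` lies in `T`, for `φ` to reach `u`.
efficientOpen⇒minimum : (G : Graph m) (noIso : NoIsolatedVertices G)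
  ((D , _) : EfficientOpenDomination G) → ∣ D ∣ ≡ γᵗ G noIso
efficientOpen⇒minimum {m} G noIso (D , cover , disj) = ≤-antisym
  (let (T , domT , ∣T∣≡γᵗ) = attained (proj₂ (γᵗ-min G noIso)) in
   ≤-trans (⊆image⇒∣p∣≤∣q∣ D T φ (covered T domT)) (≤-reflexive ∣T∣≡γᵗ))
  (lowerBound (proj₂ (γᵗ-min G noIso)) D λ v →
    let (u , u∈D , v∈Nu) = cover v in u , u∈D , adj-sym G (∈N⁻ G v∈Nu))
  where
  φ : Fin m → Fin m
  φ t = proj₁ (cover t)

  φ-unique : ∀ u t → u ∈ D → t ∈ N G u → φ t ≡ u
  φ-unique u t u∈D t∈Nu with (w , w∈D , t∈Nw) ← cover t =
    disjoint⇒unique (N G) disj w∈D u∈D t∈Nw t∈Nu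

  covered : ∀ T → TotalDominating G T → ∀ u → u ∈ D → ∃ λ t → t ∈ T × φ t ≡ u
  covered T domT u u∈D with (t , t∈T , ut) ← domT u = t , t∈T , φ-unique u t u∈D (∈N⁺ G ut)

-- Blow-ups along efficient dominating sets

blowUp-closed-roman : (G : Graph m) (H : Graph n) (h : Fin n) ((S , _) : EfficientClosedDomination G) →
  PerfectRomanDominating (G ∘ H) (blowUp G H S (rowᵐᵃˣ H h))
blowUp-closed-roman G H h (S , dom , disj) = blowUp-roman G H S (rowᵐᵃˣ H h) cover
  where
  same : ∀ {u w t} → u ∈ S → w ∈ S → t ∈ N[ G ] u → t ∈ N[ G ] w → u ≡ w
  same = disjoint⇒unique N[ G ] disj

  -- A centre seen from copy `u`, whether inside or outside that copy, lies over some `x` with `u`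
  -- in its closed neighbourhood; disjointness then gives uniqueness in all cases at once.
  lex⇒∈N[] : ∀ {u x v} → LexAdj G H (u , v) (x , h) → u ∈ N[ G ] x
  lex⇒∈N[] (inj₁ ux)         = x∈p∪q⁺ (inj₁ (∈N⁺ G (adj-sym G ux)))
  lex⇒∈N[] (inj₂ (refl , _)) = x∈p∪q⁺ (inj₂ (x∈⁅x⁆ _))

  cover : ∀ u v → u ∉ S ⊎ value (rowᵐᵃˣ H h) v ≡ 0F →
          ∃! _≡_ λ x → x ∈ S × LexAdj G H (u , v) (x , h)
  cover u v u∉S⊎zero with u ∈? S
  cover u v (inj₁ u∉S) | yes u∈S = contradiction u∈S u∉S
  cover u v (inj₂ rv≡0) | yes u∈S =
    u , (u∈S , uv∼uh) , λ { (y∈S , uv∼y) → same u∈S y∈S (lex⇒∈N[] uv∼uh) (lex⇒∈N[] uv∼y) }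
    where
    uv∼uh : LexAdj G H (u , v) (u , h)
    uv∼uh = inj₂ (refl , adj-sym H (rowᵐᵃˣ-zero H h v rv≡0))
  cover u v _ | no u∉S with (x , x∈S , ux) ← dom u u∉S =
    x , (x∈S , inj₁ ux) ,
    λ { (y∈S , uv∼y) → same x∈S y∈S (lex⇒∈N[] {v = v} (inj₁ ux)) (lex⇒∈N[] uv∼y) }

-- Every zero is covered from another copy, those in copies from `D` included, because open
-- neighbourhoods of `D` cover all of `G`. The centre of its own copy is no second cover, as the
-- zeros of `rowᵐⁱⁿ` are not adjacent to it.
blowUp-open-roman : (G : Graph m) (H : Graph n) (h : Fin n) ((D , _) : EfficientOpenDomination G) →
  PerfectRomanDominating (G ∘ H) (blowUp G H D (rowᵐⁱⁿ H h))
blowUp-open-roman G H h (D , dom , disj) = blowUp-roman G H D (rowᵐⁱⁿ H h) cover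
  where
  same : ∀ {u w t} → u ∈ D → w ∈ D → t ∈ N G u → t ∈ N G w → u ≡ w
  same = disjoint⇒unique (N G) disj

  cover : ∀ u v → u ∉ D ⊎ value (rowᵐⁱⁿ H h) v ≡ 0F →
          ∃! _≡_ λ x → x ∈ D × LexAdj G H (u , v) (x , h)
  cover u v u∉D⊎zero with (x , x∈D , u∈Nx) ← dom u =
    x , (x∈D , inj₁ (adj-sym G (∈N⁻ G u∈Nx))) , λ
      { (y∈D , inj₁ uy) → same x∈D y∈D u∈Nx (∈N⁺ G (adj-sym G uy))
      ; (y∈D , inj₂ (refl , vh)) → ⊥-elim (inner u∉D⊎zero y∈D vh) }
    where
    inner : u ∉ D ⊎ value (rowᵐⁱⁿ H h) v ≡ 0F → u ∈ D → ¬ Adj H v h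
    inner (inj₁ u∉D)  u∈D vh = u∉D u∈D
    inner (inj₂ rv≡0) u∈D vh = rowᵐⁱⁿ-zero H h v rv≡0 (adj-sym H vh)

-- Arithmetic of the bounds and the two equalities

γᵖᴿ-between : (Γ : Graph n) (k : ℕ) (f : Labelling n) →
              PerfectRomanDominating Γ f → weight f ≡ k →
              (∀ g → PerfectRomanDominating Γ g → k ≤ weight g) → γᵖᴿ Γ ≡ k
γᵖᴿ-between Γ k f prd wf≡k k≤ with γᵖᴿ-min Γ
... | l , isMin with (g , prd-g , wg≡l) ← attained isMin = ≤-antisym
  (≤-trans (lowerBound isMin f prd) (≤-reflexive wf≡k))
  (≤-trans (k≤ g prd-g) (≤-reflexive wg≡l))

-- For `d` the maximum and `e` the minimum degree: if `d` vanished, so would `e`, and the sum would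
-- be 1.
2≤d+e+1⇒1≤d : ∀ {d e} → e ≤ d → 2 ≤ d + e + 1 → 1 ≤ d
2≤d+e+1⇒1≤d {zero}  z≤n (s≤s ())
2≤d+e+1⇒1≤d {suc d} _   _ = s≤s z≤n

-- Again `d` and `e` are the maximum and minimum degree. An edgeless graph has `e` equal to 0 and
-- needs `2 ≤ k`; otherwise `d` contributes the missing 1.
d+e+1≤k⇒2+e≤k : ∀ {d e k} → e ≤ d → 2 ≤ k → d + e + 1 ≤ k → 2 + e ≤ k
d+e+1≤k⇒2+e≤k {zero}          z≤n 2≤k _ = 2≤k
d+e+1≤k⇒2+e≤k {suc d} {e} {k} _   _   d+e+1≤k = begin
  2 + e            ≤⟨ s≤s (s≤s (m≤n+m e d)) ⟩
  suc (suc d + e)  ≡⟨ +-comm 1 _ ⟩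
  suc d + e + 1    ≤⟨ d+e+1≤k ⟩
  k                ∎
  where open ≤-Reasoning

γᵖᴿ-closed : (G : Graph m) → NoIsolatedVertices G → EfficientClosedDomination G →
  (H : Graph n) → 2 ≤ n → n ≤ Δ H + δ H + 1 → γᵖᴿ (G ∘ H) ≡ γ G * (n ∸ Δ H + 1)
γᵖᴿ-closed {n = n@(suc _)} G noIso ecd H 2≤n n≤Δ+δ+1
  -- Matching the order as a successor provides the vertex `zero` of `H`.
  with (h , deg≡Δ) ← Δ-attained H zero =
  γᵖᴿ-between (G ∘ H) _ (blowUp G H (proj₁ ecd) (rowᵐᵃˣ H h)) (blowUp-closed-roman G H h ecd)
    (trans (weight-blowUp G H (proj₁ ecd) (rowᵐᵃˣ H h))
           (cong₂ _*_ (efficientClosed⇒minimum G ecd) row-weight))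
    (LowerBound.γ*c≤weight G noIso H c c≤n c≤2+deg c+deg≤1+n)
  where
  open ≤-Reasoning

  c : ℕ
  c = n ∸ Δ H + 1

  Δ≤n : Δ H ≤ n
  Δ≤n = subst (_≤ n) deg≡Δ (∣p∣≤n (N H h))

  δ≤Δ : δ H ≤ Δ H
  δ≤Δ = ≤-trans (δ≤deg H h) (deg≤Δ H h)

  -- The truncated subtraction is removed once, here; every bound on `c` below is checked after
  -- adding a degree.
  c+Δ≡1+n : c + Δ H ≡ suc n
  c+Δ≡1+n = begin-equality
    n ∸ Δ H + 1 + Δ H    ≡⟨ +-assoc (n ∸ Δ H) 1 (Δ H) ⟩
    n ∸ Δ H + suc (Δ H)  ≡⟨ +-suc (n ∸ Δ H) (Δ H) ⟩
    suc (n ∸ Δ H + Δ H)  ≡⟨ cong suc (m∸n+n≡m Δ≤n) ⟩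
    suc n                ∎

  row-weight : rowWeight (value (rowᵐᵃˣ H h)) ≡ c
  row-weight = +-cancelʳ-≡ (Δ H) _ _
    (trans (subst (λ d → rowWeight (value (rowᵐᵃˣ H h)) + d ≡ suc n) deg≡Δ (rowᵐᵃˣ-weight H h))
           (sym c+Δ≡1+n))

  1≤Δ : 1 ≤ Δ H
  1≤Δ = 2≤d+e+1⇒1≤d δ≤Δ (≤-trans 2≤n n≤Δ+δ+1)

  -- The summand 1 in `c` is absorbed because `H` has an edge.
  c≤n : c ≤ n
  c≤n = +-cancelʳ-≤ (Δ H) c n (begin
    c + Δ H  ≡⟨ c+Δ≡1+n ⟩
    suc n    ≡⟨ +-comm 1 n ⟩
    n + 1    ≤⟨ +-monoʳ-≤ n 1≤Δ ⟩
    n + Δ H  ∎)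

  -- The upper bound on the order of `H` says exactly that `c ≤ 2 + δ H`.
  c≤2+deg : ∀ y → c ≤ 2 + deg H y
  c≤2+deg y = +-cancelʳ-≤ (Δ H) c _ (begin
    c + Δ H                  ≡⟨ c+Δ≡1+n ⟩
    suc n                    ≤⟨ s≤s n≤Δ+δ+1 ⟩
    suc (Δ H + δ H + 1)      ≡⟨ cong suc (+-comm _ 1) ⟩
    2 + (Δ H + δ H)          ≡⟨ cong (2 +_) (+-comm (Δ H) (δ H)) ⟩
    2 + δ H + Δ H            ≤⟨ +-monoˡ-≤ (Δ H) (+-monoʳ-≤ 2 (δ≤deg H y)) ⟩
    2 + deg H y + Δ H        ∎)

  c+deg≤1+n : ∀ y → c + deg H y ≤ suc n
  c+deg≤1+n y = ≤-trans (+-monoʳ-≤ c (deg≤Δ H y)) (≤-reflexive c+Δ≡1+n)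

γᵖᴿ-open : (G : Graph m) (noIso : NoIsolatedVertices G) →
  γᵗ G noIso ≡ γ G → EfficientOpenDomination G →
  (H : Graph n) → 2 ≤ n → n ≥ Δ H + δ H + 1 → γᵖᴿ (G ∘ H) ≡ γ G * (2 + δ H)
γᵖᴿ-open {n = n@(suc _)} G noIso γᵗ≡γ eod H 2≤n n≥Δ+δ+1
  with (h , deg≡δ) ← δ-attained H zero =
  γᵖᴿ-between (G ∘ H) _ (blowUp G H (proj₁ eod) (rowᵐⁱⁿ H h)) (blowUp-open-roman G H h eod)
    (trans (weight-blowUp G H (proj₁ eod) (rowᵐⁱⁿ H h))
           (cong₂ _*_ (trans (efficientOpen⇒minimum G noIso eod) γᵗ≡γ)
                      (trans (rowᵐⁱⁿ-weight H h) (cong (2 +_) deg≡δ))))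
    (LowerBound.γ*c≤weight G noIso H (2 + δ H) 2+δ≤n
      (λ y → +-monoʳ-≤ 2 (δ≤deg H y)) c+deg≤1+n)
  where
  open ≤-Reasoning

  2+δ≤n : 2 + δ H ≤ n
  2+δ≤n = d+e+1≤k⇒2+e≤k (≤-trans (δ≤deg H h) (deg≤Δ H h)) 2≤n n≥Δ+δ+1

  -- The lower bound on the order of `H` is exactly this inequality for a vertex of maximum degree.
  c+deg≤1+n : ∀ y → 2 + δ H + deg H y ≤ suc n
  c+deg≤1+n y = begin
    2 + δ H + deg H y    ≤⟨ +-monoʳ-≤ (2 + δ H) (deg≤Δ H y) ⟩
    2 + (δ H + Δ H)      ≡⟨ cong (2 +_) (+-comm (δ H) (Δ H)) ⟩
    2 + (Δ H + δ H)      ≡⟨ cong suc (+-comm 1 _) ⟩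
    suc (Δ H + δ H + 1)  ≤⟨ s≤s n≥Δ+δ+1 ⟩
    suc n                ∎

theorem4p8 : {m : ℕ} (G : Graph m) (noIso : NoIsolatedVertices G) →
    (EfficientClosedDomination G →
    {n : ℕ} (H : Graph n) → 2 ≤ n → n ≤ Δ H + δ H + 1 →
    γᵖᴿ (G ∘ H) ≡ γ G * (n ∸ Δ H + 1))
    ×
    (γᵖ G ≡ γᵗ G noIso → γᵗ G noIso ≡ γ G → EfficientOpenDomination G →
    {n : ℕ} (H : Graph n) → 2 ≤ n → n ≥ Δ H + δ H + 1 →
    γᵖᴿ (G ∘ H) ≡ γ G * (2 + δ H))
theorem4p8 G noIso =
  (λ ecd H → γᵖᴿ-closed G noIso ecd H) ,
  (λ _ γᵗ≡γ eod H → γᵖᴿ-open G noIso γᵗ≡γ eod H)
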